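{- For every integer $k\ge 1$, $\chi_{la}((2k+1)P_3\vee O_3)=3$.
   Context: All graphs are finite and simple. For a graph $G=(V,E)$ with $q=|E|$ edges, a bijection $f:E\to\{1,2,\dots,q\}$ is a local antimagic labeling of $G$ if $f^+(u)\ne f^+(v)$ for every edge $uv\in E$, where $f^+(u)=\sum_{e\in E(u)}f(e)$ and $E(u)$ is the set of edges incident to $u$. The color number $c(f)$ is the number of distinct values of $f^+$ on $V$. The local antimagic chromatic number $\chi_{la}(G)$ is the minimum of $c(f)$ over all local antimagic labelings $f$ of $G$. $P_3$ is the path on 3 vertices, $nP_3$ is the disjoint union of $n$ copies of $P_3$, $O_3$ is the null (edgeless) graph on 3 vertices, and $G\vee H$ is the join of $G$ and $H$ (disjoint union together with all edges between $G$ and $H$); $(2k+1)P_3\vee O_3$ means $((2k+1)P_3)\vee O_3$. -}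

module Defs where

open import Data.Fin using (Fin; suc; toℕ; inject₁)
open import Data.Fin.Properties
  using (+↔⊎; *↔×; inj⇒≟; inject₁-injective; toℕ-inject₁)
open import Data.List using (List; tabulate; filter; map; length; deduplicate)
open import Data.Nat using (ℕ; zero; suc; _+_; _*_; _≤_; _≟_)
open import Data.Nat.ListAction using (sum)
open import Data.Nat.Properties using (m≢1+n+m; 1+n≢n)
open import Data.Product using (_×_; _,_; proj₁; proj₂; swap; ∃-syntax)
open import Data.Product.Function.NonDependent.Propositional using (_×-↔_)
open import Data.Product.Properties using (,-injectiveˡ; ,-injectiveʳ)
open import Data.Sum using (_⊎_; inj₁; inj₂)
open import Data.Sum.Function.Propositional using (_⊎-↔_)
open import Data.Sum.Properties using (inj₁-injective; inj₂-injective)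
open import Function using (_↔_; _⤖_; Inverse; Bijection)
open import Function.Construct.Composition using (_↔-∘_)
open import Function.Construct.Identity using (↔-id)
open import Function.Construct.Symmetry using (↔-sym)
open import Function.Properties.Inverse using (↔⇒↣)
open import Relation.Binary using (DecidableEquality)
open import Relation.Binary.PropositionalEquality
  using (_≡_; _≢_; refl; sym; trans; cong; cong₂)
open import Relation.Nullary using (Dec; contradiction)
open import Relation.Nullary.Decidable using (_⊎-dec_)

-- An edge e stands for the unordered pair of its two endpoints: the order
-- in which `ends` lists them is irrelevant, and `noParallel` says that an edge
-- is determined by that unordered pair.
record Graph : Set₁ where
  field
    V E  : Set
    ∣V∣  : ℕ
    ∣E∣  : ℕ
    V↔   : V ↔ Fin ∣V∣
    E↔   : E ↔ Fin ∣E∣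
    ends : E → V × V
    noLoop     : ∀ e → proj₁ (ends e) ≢ proj₂ (ends e)
    noParallel : ∀ e e′ → ends e ≡ ends e′ ⊎ ends e ≡ swap (ends e′) → e ≡ e′

  vertices : List V
  vertices = tabulate (Inverse.from V↔)

  edges : List E
  edges = tabulate (Inverse.from E↔)

  _≟V_ : DecidableEquality V
  _≟V_ = inj⇒≟ (↔⇒↣ V↔)

  Incident : V → E → Set
  Incident u e = u ≡ proj₁ (ends e) ⊎ u ≡ proj₂ (ends e)

  incident? : ∀ u e → Dec (Incident u e)
  incident? u e = (u ≟V proj₁ (ends e)) ⊎-dec (u ≟V proj₂ (ends e))

  incidentEdges : V → List E
  incidentEdges u = filter (incident? u) edges

open Graph

module _ (G : Graph) where

  -- The label set {1, …, q} is represented by Fin q, with i standing for 1 + i.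
  Labeling : Set
  Labeling = E G ⤖ Fin (∣E∣ G)

  label : Labeling → E G → ℕ
  label f e = suc (toℕ (Bijection.to f e))

  _⁺ : Labeling → V G → ℕ
  (f ⁺) u = sum (map (label f) (incidentEdges G u))

  LocalAntimagic : Labeling → Set
  LocalAntimagic f = ∀ e → (f ⁺) (proj₁ (ends G e)) ≢ (f ⁺) (proj₂ (ends G e))

  colorNumber : Labeling → ℕ
  colorNumber f = length (deduplicate _≟_ (map (f ⁺) (vertices G)))

  -- χ_la(G) = m.  This is a relation because a graph with a component K₂
  -- has no local antimagic labeling, and then the minimum does not exist.
  χla≡ : ℕ → Set
  χla≡ m = (∃[ f ] (LocalAntimagic f × colorNumber f ≡ m))
         × (∀ f → LocalAntimagic f → m ≤ colorNumber f)

null : ℕ → Graph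
null n = record
  { V = Fin n ; E = Fin 0 ; ∣V∣ = n ; ∣E∣ = 0
  ; V↔ = ↔-id _ ; E↔ = ↔-id _
  ; ends = λ () ; noLoop = λ () ; noParallel = λ () }

-- The path whose number of edges is n, so that it has suc n vertices.
pathWithEdges : ℕ → Graph
pathWithEdges n = record
  { V = Fin (suc n) ; E = Fin n ; ∣V∣ = suc n ; ∣E∣ = n
  ; V↔ = ↔-id _ ; E↔ = ↔-id _
  ; ends = λ i → inject₁ i , suc i
  ; noLoop = λ i eq → 1+n≢n (sym (trans (sym (toℕ-inject₁ i)) (cong toℕ eq)))
  ; noParallel = λ
      { i j (inj₁ eq) → inject₁-injective (,-injectiveˡ eq)
      ; i j (inj₂ eq) → contradiction
          (trans (sym (toℕ-inject₁ i))
            (trans (cong toℕ (,-injectiveˡ eq))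
              (cong suc (sym (trans (cong toℕ (,-injectiveʳ eq)) (toℕ-inject₁ j))))))
          (m≢1+n+m (toℕ i) {1}) } }

path : ℕ → Graph
path zero    = null 0
path (suc n) = pathWithEdges n

infixr 8 _copiesOf_
infixr 6 _∨_

_copiesOf_ : ℕ → Graph → Graph
n copiesOf G = record
  { V = Fin n × V G ; E = Fin n × E G
  ; ∣V∣ = n * ∣V∣ G ; ∣E∣ = n * ∣E∣ G
  ; V↔ = ↔-sym *↔× ↔-∘ (↔-id _ ×-↔ V↔ G)
  ; E↔ = ↔-sym *↔× ↔-∘ (↔-id _ ×-↔ E↔ G)
  ; ends = λ (i , e) → (i , proj₁ (ends G e)) , (i , proj₂ (ends G e))
  ; noLoop = λ (i , e) eq → noLoop G e (,-injectiveʳ eq)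
  ; noParallel = λ
      { (i , e) (j , e′) (inj₁ eq) → cong₂ _,_ (cong (λ p → proj₁ (proj₁ p)) eq)
          (noParallel G e e′ (inj₁ (cong (λ p → proj₂ (proj₁ p) , proj₂ (proj₂ p)) eq)))
      ; (i , e) (j , e′) (inj₂ eq) → cong₂ _,_ (cong (λ p → proj₁ (proj₁ p)) eq)
          (noParallel G e e′ (inj₂ (cong (λ p → proj₂ (proj₁ p) , proj₂ (proj₂ p)) eq))) } }

_∨_ : Graph → Graph → Graph
G ∨ H = record
  { V = V G ⊎ V H ; E = E G ⊎ (E H ⊎ (V G × V H))
  ; ∣V∣ = ∣V∣ G + ∣V∣ H ; ∣E∣ = ∣E∣ G + (∣E∣ H + ∣V∣ G * ∣V∣ H)
  ; V↔ = ↔-sym +↔⊎ ↔-∘ (V↔ G ⊎-↔ V↔ H)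
  ; E↔ = ↔-sym +↔⊎ ↔-∘ (E↔ G ⊎-↔ (↔-sym +↔⊎ ↔-∘ (E↔ H ⊎-↔ (↔-sym *↔× ↔-∘ (V↔ G ×-↔ V↔ H)))))
  ; ends = ends∨
  ; noLoop = noLoop∨
  ; noParallel = noParallel∨ }
  where
  ends∨ : E G ⊎ (E H ⊎ (V G × V H)) → (V G ⊎ V H) × (V G ⊎ V H)
  ends∨ (inj₁ e)              = inj₁ (proj₁ (ends G e)) , inj₁ (proj₂ (ends G e))
  ends∨ (inj₂ (inj₁ e))       = inj₂ (proj₁ (ends H e)) , inj₂ (proj₂ (ends H e))
  ends∨ (inj₂ (inj₂ (u , v))) = inj₁ u , inj₂ v

  noLoop∨ : ∀ e → proj₁ (ends∨ e) ≢ proj₂ (ends∨ e)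
  noLoop∨ (inj₁ e)        eq = noLoop G e (inj₁-injective eq)
  noLoop∨ (inj₂ (inj₁ e)) eq = noLoop H e (inj₂-injective eq)
  noLoop∨ (inj₂ (inj₂ _)) ()

  inj₁² : ∀ {a b c d : V G} → (inj₁ a , inj₁ b) ≡ (inj₁ {B = V H} c , inj₁ {B = V H} d) →
          (a , b) ≡ (c , d)
  inj₁² refl = refl

  inj₂² : ∀ {a b c d : V H} → (inj₂ a , inj₂ b) ≡ (inj₂ {A = V G} c , inj₂ {A = V G} d) →
          (a , b) ≡ (c , d)
  inj₂² refl = refl

  noParallel∨ : ∀ e e′ → ends∨ e ≡ ends∨ e′ ⊎ ends∨ e ≡ swap (ends∨ e′) → e ≡ e′
  noParallel∨ (inj₁ e) (inj₁ e′) (inj₁ eq) = cong inj₁ (noParallel G e e′ (inj₁ (inj₁² eq)))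
  noParallel∨ (inj₁ e) (inj₁ e′) (inj₂ eq) = cong inj₁ (noParallel G e e′ (inj₂ (inj₁² eq)))
  noParallel∨ (inj₁ e) (inj₂ (inj₁ e′)) (inj₁ ())
  noParallel∨ (inj₁ e) (inj₂ (inj₁ e′)) (inj₂ ())
  noParallel∨ (inj₁ e) (inj₂ (inj₂ _)) (inj₁ ())
  noParallel∨ (inj₁ e) (inj₂ (inj₂ _)) (inj₂ ())
  noParallel∨ (inj₂ (inj₁ e)) (inj₁ e′) (inj₁ ())
  noParallel∨ (inj₂ (inj₁ e)) (inj₁ e′) (inj₂ ())
  noParallel∨ (inj₂ (inj₁ e)) (inj₂ (inj₁ e′)) (inj₁ eq) =
    cong (λ x → inj₂ (inj₁ x)) (noParallel H e e′ (inj₁ (inj₂² eq)))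
  noParallel∨ (inj₂ (inj₁ e)) (inj₂ (inj₁ e′)) (inj₂ eq) =
    cong (λ x → inj₂ (inj₁ x)) (noParallel H e e′ (inj₂ (inj₂² eq)))
  noParallel∨ (inj₂ (inj₁ e)) (inj₂ (inj₂ _)) (inj₁ ())
  noParallel∨ (inj₂ (inj₁ e)) (inj₂ (inj₂ _)) (inj₂ ())
  noParallel∨ (inj₂ (inj₂ _)) (inj₁ e′) (inj₁ ())
  noParallel∨ (inj₂ (inj₂ _)) (inj₁ e′) (inj₂ ())
  noParallel∨ (inj₂ (inj₂ _)) (inj₂ (inj₁ e′)) (inj₁ ())
  noParallel∨ (inj₂ (inj₂ _)) (inj₂ (inj₁ e′)) (inj₂ ())
  noParallel∨ (inj₂ (inj₂ (u , v))) (inj₂ (inj₂ (u′ , v′))) (inj₁ refl) = refl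
  noParallel∨ (inj₂ (inj₂ _)) (inj₂ (inj₂ _)) (inj₂ ())

P₃ : Graph
P₃ = path 3

O₃ : Graph
O₃ = null 3

{-# OPTIONS --safe #-}
-- Let n = 2k + 1. The 11 edges belonging to a copy of P₃, its own two and the nine
-- joining it to O₃, fall into 11 slots; the edge of copy i in a slot gets the label
-- 1 + n b + π(i), with b the block of the slot and π its permutation of {0, …, n − 1}.
-- Around an end vertex of a path, π alternates between the identity and the reversal,
-- whose sum is constant. A middle vertex sees such a pair on its two path edges, and
-- reversal, σ, τ on its edges to O₃, where σ(i) + τ(i) = i + k; this needs n odd.
-- At a vertex of O₃ the end vertices of each path contribute an identity–reversal pair,
-- and the middle one a permutation, whose sum over i does not depend on it. The blocks
-- are chosen to equalise the constants, which leaves three values. Fewer are impossible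
-- because the graph contains triangles.
module Submission where

open import Defs
open import Data.Nat using (ℕ; _+_; _*_; _≤_)

open import Data.Fin using (Fin; toℕ; splitAt; remQuot; quotRem; opposite; #_; combine; _↑ˡ_; _↑ʳ_)
  renaming (suc to fsuc)
open import Data.Fin.Patterns using (0F; 1F; 2F; 3F; 4F; 5F; 6F; 7F; 8F; 9F)
open import Data.Fin.Permutation using (Permutation′; _⟨$⟩ʳ_; _⟨$⟩ˡ_; inverseˡ; inverseʳ; cast-id; reverse)
  renaming (id to idₚ)
open import Data.Fin.Properties
  using (+↔⊎; *↔×; toℕ-combine; toℕ-cast; toℕ-↑ˡ; toℕ-↑ʳ; toℕ<n; opposite-prop; opposite-involutive; injective⇒≤; all?)
  renaming (_≟_ to _≟F_)
open import Data.List
  using (List; []; _∷_; [_]; _++_; map; filter; tabulate; allFin; length; lookup; deduplicate; cartesianProduct)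
open import Data.List.Membership.Propositional using (_∈_)
open import Data.List.Membership.Propositional.Properties
  using (∈-tabulate⁺; ∈-map⁺; ∈-map⁻; ∈-lookup; ∈-deduplicate⁺; ∈-deduplicate⁻)
open import Data.List.Membership.Setoid.Properties using (index-injective)
open import Data.List.Properties
  using (map-++; map-∘; map-cong; map-tabulate; length-map; filter-++; filter-≐; filter-none; filter-all; ++-identityʳ)
open import Data.List.Relation.Binary.Subset.Propositional using (_⊆_)
open import Data.List.Relation.Unary.All as All using (All; []; _∷_)
open import Data.List.Relation.Unary.AllPairs using ([]; _∷_)
open import Data.List.Relation.Unary.Any using (here; there)
open import Data.List.Relation.Unary.Unique.DecPropositional.Properties using (deduplicate-!)
open import Data.List.Relation.Unary.Unique.Propositional using (Unique)
open import Data.List.Relation.Unary.Unique.Propositional.Properties using (tabulate⁺; allFin⁺)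
open import Data.Nat using (zero; suc; _<_; s≤s; _≟_)
open import Data.Nat.ListAction using (sum)
open import Data.Nat.ListAction.Properties using (sum-++)
open import Data.Nat.Properties
  using (+-0-commutativeMonoid; *-comm; m+[n∸m]≡n; m≤m+n; <⇒≢; <-trans; ≤-trans; ≤-antisym)
open import Algebra.Properties.CommutativeMonoid.Sum +-0-commutativeMonoid
  using (sum-permute) renaming (sum to ∑)
open import Data.Nat.Tactic.RingSolver using (solve-∀)
open import Data.Product as Product using (_×_; _,_; proj₁; proj₂)
open import Data.Product.Function.NonDependent.Propositional using (_×-↔_)
open import Data.Sum as Sum using (_⊎_; inj₁; inj₂)
open import Data.Sum.Function.Propositional using (_⊎-↔_)
open import Data.Unit using (⊤; tt)
open import Function using (_∘_; id; _↔_; Inverse; Injection; mk↔ₛ′)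
open import Function.Construct.Composition using (_↔-∘_)
open import Function.Construct.Identity using (↔-id)
open import Function.Construct.Symmetry using (↔-sym)
open import Function.Properties.Inverse using (↔⇒↣; ↔⇒⤖)
open import Relation.Binary.PropositionalEquality
  using (_≡_; _≢_; refl; sym; trans; cong; cong₂; subst; setoid; module ≡-Reasoning)
open import Relation.Nullary using (yes; no; contradiction)
open import Relation.Nullary.Decidable using (from-yes)
open import Relation.Unary using (Pred; Decidable)
open import Relation.Unary.Properties using (U?)
open import Level using (0ℓ)

private variable
  A B : Set
  m n : ℕ

-- Tabulated lists, filters and sums over lists.

tabulate-++ : (h : Fin m ⊎ Fin n → A) →
  tabulate (h ∘ splitAt m) ≡ tabulate (h ∘ inj₁) ++ tabulate (h ∘ inj₂)
tabulate-++ {m = zero}  h = refl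
tabulate-++ {m = suc m} h = cong (h (inj₁ 0F) ∷_) (tabulate-++ (h ∘ Sum.map fsuc id))

tabulate-⊎ : (f : Fin m → A) (g : Fin n → B) →
  tabulate (Sum.map f g ∘ splitAt m) ≡ map inj₁ (tabulate f) ++ map inj₂ (tabulate g)
tabulate-⊎ f g = trans (tabulate-++ (Sum.map f g))
  (cong₂ _++_ (sym (map-tabulate f inj₁)) (sym (map-tabulate g inj₂)))

tabulate-× : (f : Fin m → A) (g : Fin n → B) →
  tabulate (Product.map f g ∘ remQuot {m} n) ≡ cartesianProduct (tabulate f) (tabulate g)
tabulate-× {m = zero}          f g = refl
tabulate-× {m = suc m} {n = n} f g = trans
  -- The argument is what `remQuot` does after its `splitAt n`: the first n indices form the row of
  -- `f 0F`, the others recurse with the row shifted by one.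
  (tabulate-++ {n} {m * n} (Product.map f g ∘ Product.swap ∘ Sum.[ (_, 0F) , Product.map₂ fsuc ∘ quotRem {m} n ]))
  (cong₂ _++_ (sym (map-tabulate g (f 0F ,_))) (tabulate-× (f ∘ fsuc) g))

filter-map : {P : Pred B 0ℓ} (P? : Decidable P) (f : A → B) (xs : List A) →
  filter P? (map f xs) ≡ map f (filter (P? ∘ f) xs)
filter-map P? f []       = refl
filter-map P? f (x ∷ xs) with P? (f x)
... | yes _ = cong (f x ∷_) (filter-map P? f xs)
... | no  _ = filter-map P? f xs

sum-filter-⊎ : (g : A ⊎ B → ℕ) {P : Pred (A ⊎ B) 0ℓ} (P? : Decidable P) (xs : List A) (ys : List B) →
  sum (map g (filter P? (map inj₁ xs ++ map inj₂ ys))) ≡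
    sum (map (g ∘ inj₁) (filter (P? ∘ inj₁) xs)) + sum (map (g ∘ inj₂) (filter (P? ∘ inj₂) ys))
sum-filter-⊎ g P? xs ys = begin
  sum (map g (filter P? (map inj₁ xs ++ map inj₂ ys)))
    ≡⟨ cong (sum ∘ map g) (filter-++ P? (map inj₁ xs) (map inj₂ ys)) ⟩
  sum (map g (filter P? (map inj₁ xs) ++ filter P? (map inj₂ ys)))
    ≡⟨ cong (sum ∘ map g) (cong₂ _++_ (filter-map P? inj₁ xs) (filter-map P? inj₂ ys)) ⟩
  sum (map g (map inj₁ (filter (P? ∘ inj₁) xs) ++ map inj₂ (filter (P? ∘ inj₂) ys)))
    ≡⟨ cong sum (map-++ g (map inj₁ (filter (P? ∘ inj₁) xs)) _) ⟩
  sum (map g (map inj₁ (filter (P? ∘ inj₁) xs)) ++ map g (map inj₂ (filter (P? ∘ inj₂) ys)))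
    ≡⟨ sum-++ (map g (map inj₁ (filter (P? ∘ inj₁) xs))) _ ⟩
  sum (map g (map inj₁ (filter (P? ∘ inj₁) xs))) + sum (map g (map inj₂ (filter (P? ∘ inj₂) ys)))
    ≡⟨ cong₂ (λ is js → sum is + sum js)
         (map-∘ (filter (P? ∘ inj₁) xs)) (map-∘ (filter (P? ∘ inj₂) ys)) ⟨
  sum (map (g ∘ inj₁) (filter (P? ∘ inj₁) xs)) + sum (map (g ∘ inj₂) (filter (P? ∘ inj₂) ys)) ∎
  where open ≡-Reasoning

filter-≡ : {u : A} {xs : List A} (u≟ : Decidable (u ≡_)) → Unique xs → u ∈ xs →
  filter u≟ xs ≡ [ u ]
filter-≡ {u = u} {x ∷ xs} u≟ (x∉xs ∷ !xs) u∈ with u≟ x | u∈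
... | yes refl | _         = cong (u ∷_) (filter-none u≟ x∉xs)
... | no  u≢x  | here u≡x  = contradiction u≡x u≢x
... | no  _    | there u∈′ = filter-≡ u≟ !xs u∈′

-- Row by row: if `Q x` holds, `P` restricted to the row of x is equivalent to `R`; otherwise
-- nothing in the row survives. Incidence, both in copies and in joins, factors in this way.
filter-cartesianProduct : {P : Pred (A × B) 0ℓ} {Q : Pred A 0ℓ} {R : Pred B 0ℓ}
  (P? : Decidable P) (Q? : Decidable Q) (R? : Decidable R) →
  (∀ {x y} → P (x , y) → Q x × R y) → (∀ {x y} → Q x → R y → P (x , y)) →
  ∀ xs ys → filter P? (cartesianProduct xs ys) ≡ cartesianProduct (filter Q? xs) (filter R? ys)
filter-cartesianProduct P? Q? R? split pair []       ys = refl
filter-cartesianProduct P? Q? R? split pair (x ∷ xs) ys = begin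
  filter P? (map (x ,_) ys ++ cartesianProduct xs ys)
    ≡⟨ filter-++ P? (map (x ,_) ys) (cartesianProduct xs ys) ⟩
  filter P? (map (x ,_) ys) ++ filter P? (cartesianProduct xs ys)
    ≡⟨ cong₂ _++_ (filter-map P? (x ,_) ys) (filter-cartesianProduct P? Q? R? split pair xs ys) ⟩
  map (x ,_) (filter (P? ∘ (x ,_)) ys) ++ cartesianProduct (filter Q? xs) (filter R? ys)
    ≡⟨ row ⟩
  cartesianProduct (filter Q? (x ∷ xs)) (filter R? ys) ∎
  where
  open ≡-Reasoning
  row : map (x ,_) (filter (P? ∘ (x ,_)) ys) ++ cartesianProduct (filter Q? xs) (filter R? ys)
      ≡ cartesianProduct (filter Q? (x ∷ xs)) (filter R? ys)
  row with Q? x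
  ... | yes q = cong (λ zs → map (x ,_) zs ++ _)
                  (filter-≐ (P? ∘ (x ,_)) R? (proj₂ ∘ split , pair q) ys)
  ... | no ¬q = cong (λ zs → map (x ,_) zs ++ _)
                  (filter-none (P? ∘ (x ,_)) (All.universal (λ _ → ¬q ∘ proj₁ ∘ split) ys))

cartesianProduct-[_]ˡ : (x : A) (ys : List B) → cartesianProduct [ x ] ys ≡ map (x ,_) ys
cartesianProduct-[ x ]ˡ ys = ++-identityʳ _

cartesianProduct-[_]ʳ : (y : B) (xs : List A) → cartesianProduct xs [ y ] ≡ map (_, y) xs
cartesianProduct-[ y ]ʳ []       = refl
cartesianProduct-[ y ]ʳ (x ∷ xs) = cong (_ ∷_) (cartesianProduct-[ y ]ʳ xs)

sum-cartesianProduct : (g : A × B → ℕ) (xs : List A) (ys : List B) →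
  sum (map g (cartesianProduct xs ys)) ≡ sum (map (λ x → sum (map (λ y → g (x , y)) ys)) xs)
sum-cartesianProduct g []       ys = refl
sum-cartesianProduct g (x ∷ xs) ys = begin
  sum (map g (map (x ,_) ys ++ cartesianProduct xs ys))
    ≡⟨ cong sum (map-++ g (map (x ,_) ys) (cartesianProduct xs ys)) ⟩
  sum (map g (map (x ,_) ys) ++ map g (cartesianProduct xs ys))
    ≡⟨ sum-++ (map g (map (x ,_) ys)) (map g (cartesianProduct xs ys)) ⟩
  sum (map g (map (x ,_) ys)) + sum (map g (cartesianProduct xs ys))
    ≡⟨ cong₂ _+_ (cong sum (sym (map-∘ ys))) (sum-cartesianProduct g xs ys) ⟩
  sum (map (λ y → g (x , y)) ys) + sum (map (λ x → sum (map (λ y → g (x , y)) ys)) xs) ∎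
  where open ≡-Reasoning

sum-tabulate : (f : Fin n → ℕ) → sum (tabulate f) ≡ ∑ f
sum-tabulate {n = zero}  f = refl
sum-tabulate {n = suc n} f = cong (f 0F +_) (sum-tabulate (f ∘ fsuc))

sum-tabulate-const+ : ∀ c (f : Fin n → ℕ) →
  sum (tabulate (λ i → c + f i)) ≡ n * c + sum (tabulate f)
sum-tabulate-const+ {n = zero}  c f = refl
sum-tabulate-const+ {n = suc n} c f = trans
  (cong (c + f 0F +_) (sum-tabulate-const+ c (f ∘ fsuc)))
  (+-interchange c (f 0F) (n * c) _)
  where
  +-interchange : ∀ a b c d → a + b + (c + d) ≡ a + c + (b + d)
  +-interchange = solve-∀

-- Reindexing by π leaves the sum unchanged. This is why the three vertices of `O₃` get the same
-- color although their middle permutations differ.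
sum-allFin-permute : ∀ c (π : Permutation′ n) →
  sum (map (λ i → c + toℕ (π ⟨$⟩ʳ i)) (allFin n)) ≡ n * c + sum (tabulate {n = n} toℕ)
sum-allFin-permute {n = n} c π = begin
  sum (map (λ i → c + toℕ (π ⟨$⟩ʳ i)) (allFin n)) ≡⟨ cong sum (map-tabulate {n = n} id (λ i → c + toℕ (π ⟨$⟩ʳ i))) ⟩
  sum (tabulate (λ i → c + toℕ (π ⟨$⟩ʳ i)))       ≡⟨ sum-tabulate-const+ c (toℕ ∘ (π ⟨$⟩ʳ_)) ⟩
  n * c + sum (tabulate (toℕ ∘ (π ⟨$⟩ʳ_)))        ≡⟨ cong (n * c +_) permuted ⟩
  n * c + sum (tabulate {n = n} toℕ)              ∎
  where
  open ≡-Reasoning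
  permuted : sum (tabulate (toℕ ∘ (π ⟨$⟩ʳ_))) ≡ sum (tabulate {n = n} toℕ)
  permuted = trans (sum-tabulate (toℕ ∘ (π ⟨$⟩ʳ_)))
    (trans (sym (sum-permute toℕ π)) (sym (sum-tabulate (toℕ {n}))))

-- Lengths of duplicate-free lists and color numbers.

lookup-injective : {xs : List A} → Unique xs → ∀ {i j} → lookup xs i ≡ lookup xs j → i ≡ j
lookup-injective (_ ∷ _)      {0F}     {0F}     _  = refl
lookup-injective (x∉xs ∷ _)   {0F}     {fsuc j} eq = contradiction eq (All.lookup x∉xs (∈-lookup j))
lookup-injective (x∉xs ∷ _)   {fsuc i} {0F}     eq = contradiction (sym eq) (All.lookup x∉xs (∈-lookup i))
lookup-injective (_ ∷ !xs)    {fsuc i} {fsuc j} eq = cong fsuc (lookup-injective !xs eq)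

-- Pigeonhole: sending a position in `xs` to the position of the same element in `ys` is injective.
Unique-⊆⇒length≤ : {xs ys : List A} → Unique xs → xs ⊆ ys → length xs ≤ length ys
Unique-⊆⇒length≤ {A} !xs xs⊆ys = injective⇒≤ λ {i} {j} eq →
  lookup-injective !xs (index-injective (setoid A) (xs⊆ys (∈-lookup i)) (xs⊆ys (∈-lookup j)) eq)

open Graph

module _ (G : Graph) where

  ∈-vertices : ∀ u → u ∈ vertices G
  ∈-vertices u = subst (_∈ vertices G) (Inverse.strictlyInverseʳ (V↔ G) u)
    (∈-tabulate⁺ (Inverse.to (V↔ G) u))

  vertices-unique : Unique (vertices G)
  vertices-unique = tabulate⁺ (Injection.injective (↔⇒↣ (↔-sym (V↔ G))))

  incidentSum : (E G → ℕ) → V G → ℕ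
  incidentSum g u = sum (map g (incidentEdges G u))

  colors : Labeling G → List ℕ
  colors f = map ((G ⁺) f) (vertices G)

  colorNumber-≥ : (f : Labeling G) {us : List (V G)} → Unique (map ((G ⁺) f) us) →
    length us ≤ colorNumber G f
  colorNumber-≥ f {us} !us = subst (_≤ colorNumber G f) (length-map ((G ⁺) f) us)
    (Unique-⊆⇒length≤ !us λ c∈ → let u , _ , c≡ = ∈-map⁻ ((G ⁺) f) c∈ in
      ∈-deduplicate⁺ _≟_ (subst (_∈ colors f) (sym c≡) (∈-map⁺ ((G ⁺) f) (∈-vertices u))))

  colorNumber-≤ : (f : Labeling G) {cs : List ℕ} → (∀ u → (G ⁺) f u ∈ cs) →
    colorNumber G f ≤ length cs
  colorNumber-≤ f {cs} ⁺∈cs = Unique-⊆⇒length≤ (deduplicate-! _≟_ (colors f)) λ c∈ →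
    let u , _ , c≡ = ∈-map⁻ ((G ⁺) f) (∈-deduplicate⁻ _≟_ (colors f) c∈) in
    subst (_∈ cs) (sym c≡) (⁺∈cs u)

-- Incident sums in disjoint copies.

module _ (n : ℕ) (G : Graph) where

  -- The inverse of the composite bijection `V↔` reduces to a product map after `remQuot`, the form
  -- that `tabulate-×` handles; likewise for the edges.
  vertices-copies : vertices (n copiesOf G) ≡ cartesianProduct (allFin n) (vertices G)
  vertices-copies = tabulate-× id _

  edges-copies : edges (n copiesOf G) ≡ cartesianProduct (allFin n) (edges G)
  edges-copies = tabulate-× id _

  incidentSum-copies : ∀ g i u →
    incidentSum (n copiesOf G) g (i , u) ≡ incidentSum G (λ e → g (i , e)) u
  incidentSum-copies g i u = cong sum (begin
    map g (filter P? (edges (n copiesOf G)))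
      ≡⟨ cong (map g ∘ filter P?) edges-copies ⟩
    map g (filter P? (cartesianProduct (allFin n) (edges G)))
      ≡⟨ cong (map g) (filter-cartesianProduct P? (i ≟F_) (incident? G u) split pair (allFin n) (edges G)) ⟩
    map g (cartesianProduct (filter (i ≟F_) (allFin n)) (incidentEdges G u))
      ≡⟨ cong (λ is → map g (cartesianProduct is (incidentEdges G u)))
           (filter-≡ (i ≟F_) (allFin⁺ n) (∈-tabulate⁺ i)) ⟩
    map g (cartesianProduct [ i ] (incidentEdges G u))
      ≡⟨ cong (map g) (cartesianProduct-[ i ]ˡ (incidentEdges G u)) ⟩
    map g (map (i ,_) (incidentEdges G u))
      ≡⟨ map-∘ (incidentEdges G u) ⟨
    map (λ e → g (i , e)) (incidentEdges G u) ∎)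
    where
    open ≡-Reasoning
    P? = incident? (n copiesOf G) (i , u)
    split : ∀ {j e} → Incident (n copiesOf G) (i , u) (j , e) → i ≡ j × Incident G u e
    split (inj₁ refl) = refl , inj₁ refl
    split (inj₂ refl) = refl , inj₂ refl
    pair : ∀ {j e} → i ≡ j → Incident G u e → Incident (n copiesOf G) (i , u) (j , e)
    pair refl (inj₁ refl) = inj₁ refl
    pair refl (inj₂ refl) = inj₂ refl

-- Incident sums in joins.

module _ (G H : Graph) where

  edges-∨ : edges (G ∨ H) ≡ map inj₁ (edges G) ++
    map inj₂ (map inj₁ (edges H) ++ map inj₂ (cartesianProduct (vertices G) (vertices H)))
  edges-∨ = trans (tabulate-⊎ from-G (Sum.map from-H from-× ∘ splitAt (∣E∣ H)))
    (cong (λ es → map inj₁ (edges G) ++ map inj₂ es)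
      (trans (tabulate-⊎ from-H from-×)
        (cong (λ es → map inj₁ (edges H) ++ map inj₂ es)
          (tabulate-× (Inverse.from (V↔ G)) (Inverse.from (V↔ H))))))
    where
    from-G = Inverse.from (E↔ G)
    from-H = Inverse.from (E↔ H)
    from-× : Fin (∣V∣ G * ∣V∣ H) → V G × V H
    from-× = Product.map (Inverse.from (V↔ G)) (Inverse.from (V↔ H)) ∘ remQuot (∣V∣ H)

  sum-filter-edges-∨ : (g : E (G ∨ H) → ℕ) {P : Pred (E (G ∨ H)) 0ℓ} (P? : Decidable P) →
    sum (map g (filter P? (edges (G ∨ H)))) ≡
      sum (map (g ∘ inj₁) (filter (P? ∘ inj₁) (edges G)))
      + (sum (map (g ∘ inj₂ ∘ inj₁) (filter (P? ∘ inj₂ ∘ inj₁) (edges H)))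
      + sum (map (g ∘ inj₂ ∘ inj₂)
          (filter (P? ∘ inj₂ ∘ inj₂) (cartesianProduct (vertices G) (vertices H)))))
  sum-filter-edges-∨ g P? = begin
    sum (map g (filter P? (edges (G ∨ H))))
      ≡⟨ cong (sum ∘ map g ∘ filter P?) edges-∨ ⟩
    sum (map g (filter P? (map inj₁ (edges G) ++ map inj₂ (map inj₁ (edges H) ++ map inj₂ GH))))
      ≡⟨ sum-filter-⊎ g P? (edges G) _ ⟩
    sum (map (g ∘ inj₁) (filter (P? ∘ inj₁) (edges G)))
      + sum (map (g ∘ inj₂) (filter (P? ∘ inj₂) (map inj₁ (edges H) ++ map inj₂ GH)))
      ≡⟨ cong (sum (map (g ∘ inj₁) (filter (P? ∘ inj₁) (edges G))) +_)
           (sum-filter-⊎ (g ∘ inj₂) (P? ∘ inj₂) (edges H) GH) ⟩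
    _ ∎
    where
    open ≡-Reasoning
    GH = cartesianProduct (vertices G) (vertices H)

  -- No edge of `H` meets u, and the joining edges at u are the pairs with first coordinate u, one
  -- for each vertex of `H`.
  incidentSum-∨ˡ : ∀ g u → incidentSum (G ∨ H) g (inj₁ u) ≡
    incidentSum G (g ∘ inj₁) u + sum (map (λ v → g (inj₂ (inj₂ (u , v)))) (vertices H))
  incidentSum-∨ˡ g u = trans (sum-filter-edges-∨ g P?) (cong₂ _+_
    (cong (sum ∘ map (g ∘ inj₁)) (filter-≐ (P? ∘ inj₁) (incident? G u) (unwrap , wrap) (edges G)))
    (cong₂ _+_
      (cong (sum ∘ map (g ∘ inj₂ ∘ inj₁))
        (filter-none (P? ∘ inj₂ ∘ inj₁) (All.universal (λ _ → λ { (inj₁ ()) ; (inj₂ ()) }) (edges H))))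
      (cong sum star)))
    where
    open ≡-Reasoning
    P? = incident? (G ∨ H) (inj₁ u)
    unwrap : ∀ {e} → Incident (G ∨ H) (inj₁ u) (inj₁ e) → Incident G u e
    unwrap (inj₁ refl) = inj₁ refl
    unwrap (inj₂ refl) = inj₂ refl
    wrap : ∀ {e} → Incident G u e → Incident (G ∨ H) (inj₁ u) (inj₁ e)
    wrap (inj₁ refl) = inj₁ refl
    wrap (inj₂ refl) = inj₂ refl
    -- The trivial condition on y puts incidence in product form.
    split : ∀ {x y} → Incident (G ∨ H) (inj₁ u) (inj₂ (inj₂ (x , y))) → u ≡ x × ⊤
    split (inj₁ refl) = refl , tt
    split (inj₂ ())
    g′ = g ∘ inj₂ ∘ inj₂
    star : map g′ (filter (P? ∘ inj₂ ∘ inj₂) (cartesianProduct (vertices G) (vertices H)))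
         ≡ map (λ v → g′ (u , v)) (vertices H)
    star = begin
      map g′ (filter (P? ∘ inj₂ ∘ inj₂) (cartesianProduct (vertices G) (vertices H)))
        ≡⟨ cong (map g′) (filter-cartesianProduct (P? ∘ inj₂ ∘ inj₂) (_≟V_ G u) U?
             split (λ { refl _ → inj₁ refl }) (vertices G) (vertices H)) ⟩
      map g′ (cartesianProduct (filter (_≟V_ G u) (vertices G)) (filter U? (vertices H)))
        ≡⟨ cong₂ (λ us vs → map g′ (cartesianProduct us vs))
             (filter-≡ (_≟V_ G u) (vertices-unique G) (∈-vertices G u))
             (filter-all U? (All.universal (λ _ → tt) (vertices H))) ⟩
      map g′ (cartesianProduct [ u ] (vertices H))
        ≡⟨ cong (map g′) (cartesianProduct-[ u ]ˡ (vertices H)) ⟩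
      map g′ (map (u ,_) (vertices H))
        ≡⟨ map-∘ (vertices H) ⟨
      map (λ v → g′ (u , v)) (vertices H) ∎

  incidentSum-∨ʳ : ∀ g v → incidentSum (G ∨ H) g (inj₂ v) ≡
    incidentSum H (g ∘ inj₂ ∘ inj₁) v + sum (map (λ u → g (inj₂ (inj₂ (u , v)))) (vertices G))
  incidentSum-∨ʳ g v = trans (sum-filter-edges-∨ g P?) (cong₂ _+_
    (cong (sum ∘ map (g ∘ inj₁))
      (filter-none (P? ∘ inj₁) (All.universal (λ _ → λ { (inj₁ ()) ; (inj₂ ()) }) (edges G))))
    (cong₂ _+_
      (cong (sum ∘ map (g ∘ inj₂ ∘ inj₁))
        (filter-≐ (P? ∘ inj₂ ∘ inj₁) (incident? H v) (unwrap , wrap) (edges H)))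
      (cong sum star)))
    where
    open ≡-Reasoning
    P? = incident? (G ∨ H) (inj₂ v)
    unwrap : ∀ {e} → Incident (G ∨ H) (inj₂ v) (inj₂ (inj₁ e)) → Incident H v e
    unwrap (inj₁ refl) = inj₁ refl
    unwrap (inj₂ refl) = inj₂ refl
    wrap : ∀ {e} → Incident H v e → Incident (G ∨ H) (inj₂ v) (inj₂ (inj₁ e))
    wrap (inj₁ refl) = inj₁ refl
    wrap (inj₂ refl) = inj₂ refl
    split : ∀ {x y} → Incident (G ∨ H) (inj₂ v) (inj₂ (inj₂ (x , y))) → ⊤ × v ≡ y
    split (inj₁ ())
    split (inj₂ refl) = tt , refl
    g′ = g ∘ inj₂ ∘ inj₂
    star : map g′ (filter (P? ∘ inj₂ ∘ inj₂) (cartesianProduct (vertices G) (vertices H)))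
         ≡ map (λ u → g′ (u , v)) (vertices G)
    star = begin
      map g′ (filter (P? ∘ inj₂ ∘ inj₂) (cartesianProduct (vertices G) (vertices H)))
        ≡⟨ cong (map g′) (filter-cartesianProduct (P? ∘ inj₂ ∘ inj₂) U? (_≟V_ H v)
             split (λ { _ refl → inj₂ refl }) (vertices G) (vertices H)) ⟩
      map g′ (cartesianProduct (filter U? (vertices G)) (filter (_≟V_ H v) (vertices H)))
        ≡⟨ cong₂ (λ us vs → map g′ (cartesianProduct us vs))
             (filter-all U? (All.universal (λ _ → tt) (vertices G)))
             (filter-≡ (_≟V_ H v) (vertices-unique H) (∈-vertices H v)) ⟩
      map g′ (cartesianProduct (vertices G) [ v ])
        ≡⟨ cong (map g′) (cartesianProduct-[ v ]ʳ (vertices G)) ⟩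
      map g′ (map (_, v) (vertices G))
        ≡⟨ map-∘ (vertices G) ⟨
      map (λ u → g′ (u , v)) (vertices G) ∎

-- Permutations with constant or shifted sums.

toℕ-opposite : (i : Fin n) → suc (toℕ i + toℕ (opposite i)) ≡ n
toℕ-opposite i = trans (cong (suc (toℕ i) +_) (opposite-prop i)) (m+[n∸m]≡n (toℕ<n i))

module Halving (k : ℕ) where

  -- `inj₁ (j , b)` stands for the number 2j + b and `inj₂ 0F` for the top number 2k.
  Cell : Set
  Cell = (Fin k × Fin 2) ⊎ Fin 1

  alternating : Cell ↔ Fin (2 * k + 1)
  alternating = cast-id (cong (_+ 1) (*-comm k 2)) ↔-∘ (↔-sym +↔⊎ ↔-∘ (↔-sym *↔× ⊎-↔ ↔-id _))

  -- Odd numbers go to 0, ..., k - 1, even ones below the top to k, ..., 2k - 1, and the top stays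
  -- at 2k. On `Fin 2`, `opposite` exchanges the parities.
  odd-even-top : Cell ↔ Fin (2 * k + 1)
  odd-even-top = ↔-sym +↔⊎ ↔-∘ ((↔-sym *↔× ↔-∘ oddFirst) ⊎-↔ ↔-id _)
    where
    oddFirst : (Fin k × Fin 2) ↔ (Fin 2 × Fin k)
    oddFirst = mk↔ₛ′ (λ (j , b) → opposite b , j) (λ (b , j) → j , opposite b)
      (λ (b , j) → cong (_, j) (opposite-involutive b)) (λ (j , b) → cong (j ,_) (opposite-involutive b))

  -- Even numbers below the top go to 0, ..., k - 1, the top to k, odd ones to k + 1, ..., 2k.
  even-top-odd : Cell ↔ Fin (2 * k + 1)
  even-top-odd = cast-id (sizes k) ↔-∘ (↔-sym +↔⊎ ↔-∘ ((↔-id _ ⊎-↔ ↔-sym +↔⊎) ↔-∘ regroup))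
    where
    sizes : ∀ k → k + (1 + k) ≡ 2 * k + 1
    sizes = solve-∀
    regroup : Cell ↔ (Fin k ⊎ (Fin 1 ⊎ Fin k))
    regroup = mk↔ₛ′
      (λ { (inj₁ (j , 0F)) → inj₁ j ; (inj₁ (j , 1F)) → inj₂ (inj₂ j) ; (inj₂ t) → inj₂ (inj₁ t) })
      (λ { (inj₁ j) → inj₁ (j , 0F) ; (inj₂ (inj₂ j)) → inj₁ (j , 1F) ; (inj₂ (inj₁ t)) → inj₂ t })
      (λ { (inj₁ _) → refl ; (inj₂ (inj₂ _)) → refl ; (inj₂ (inj₁ _)) → refl })
      (λ { (inj₁ (_ , 0F)) → refl ; (inj₁ (_ , 1F)) → refl ; (inj₂ _) → refl })

  open Inverse using (to)

  toℕ-alternating : ∀ j b → toℕ (to alternating (inj₁ (j , b))) ≡ 2 * toℕ j + toℕ b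
  toℕ-alternating j b = trans (toℕ-cast _ (combine j b ↑ˡ 1))
    (trans (toℕ-↑ˡ (combine j b) 1) (toℕ-combine j b))

  toℕ-odd-even : ∀ j b → toℕ (to odd-even-top (inj₁ (j , b))) ≡ k * toℕ (opposite b) + toℕ j
  toℕ-odd-even j b = trans (toℕ-↑ˡ (combine (opposite b) j) 1) (toℕ-combine (opposite b) j)

  -- The number 2j gives (k + j) + j, the number 2j + 1 gives j + (k + 1 + j), and the top gives 2k
  -- + k.
  toℕ-cells : ∀ c → toℕ (to odd-even-top c) + toℕ (to even-top-odd c) ≡ toℕ (to alternating c) + k
  toℕ-cells (inj₁ (j , 0F)) = begin
    toℕ (to odd-even-top (inj₁ (j , 0F))) + toℕ (to even-top-odd (inj₁ (j , 0F)))
      ≡⟨ cong₂ _+_ (toℕ-odd-even j 0F) (trans (toℕ-cast _ (j ↑ˡ (1 + k))) (toℕ-↑ˡ j (1 + k))) ⟩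
    (k * 1 + toℕ j) + toℕ j
      ≡⟨ arith k (toℕ j) ⟩
    (2 * toℕ j + 0) + k
      ≡⟨ cong (_+ k) (toℕ-alternating j 0F) ⟨
    toℕ (to alternating (inj₁ (j , 0F))) + k ∎
    where
    open ≡-Reasoning
    arith : ∀ k j → (k * 1 + j) + j ≡ (2 * j + 0) + k
    arith = solve-∀
  toℕ-cells (inj₁ (j , 1F)) = begin
    toℕ (to odd-even-top (inj₁ (j , 1F))) + toℕ (to even-top-odd (inj₁ (j , 1F)))
      ≡⟨ cong₂ _+_ (toℕ-odd-even j 1F) (trans (toℕ-cast _ (k ↑ʳ fsuc j)) (toℕ-↑ʳ k (fsuc j))) ⟩
    (k * 0 + toℕ j) + (k + suc (toℕ j))
      ≡⟨ arith k (toℕ j) ⟩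
    (2 * toℕ j + 1) + k
      ≡⟨ cong (_+ k) (toℕ-alternating j 1F) ⟨
    toℕ (to alternating (inj₁ (j , 1F))) + k ∎
    where
    open ≡-Reasoning
    arith : ∀ k j → (k * 0 + j) + (k + suc j) ≡ (2 * j + 1) + k
    arith = solve-∀
  toℕ-cells (inj₂ 0F) = begin
    toℕ (to odd-even-top (inj₂ 0F)) + toℕ (to even-top-odd (inj₂ 0F))
      ≡⟨ cong₂ _+_ (toℕ-↑ʳ (2 * k) 0F) (trans (toℕ-cast _ (k ↑ʳ 0F)) (toℕ-↑ʳ k 0F)) ⟩
    (2 * k + 0) + (k + 0)
      ≡⟨ arith k ⟩
    (k * 2 + 0) + k
      ≡⟨ cong (_+ k) (trans (toℕ-cast _ (k * 2 ↑ʳ 0F)) (toℕ-↑ʳ (k * 2) 0F)) ⟨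
    toℕ (to alternating (inj₂ 0F)) + k ∎
    where
    open ≡-Reasoning
    arith : ∀ k → (2 * k + 0) + (k + 0) ≡ (k * 2 + 0) + k
    arith = solve-∀

  -- As c runs through the cells, `alternating` lists 0, 1, …, 2k, while the other two
  -- list k, 0, k+1, 1, …, 2k and 0, k+1, 1, k+2, …, k.
  σ τ : Permutation′ (2 * k + 1)
  σ = odd-even-top ↔-∘ ↔-sym alternating
  τ = even-top-odd ↔-∘ ↔-sym alternating

  -- The shift k is forced: summing over all i, the 2k + 1 shifts must add up to 0 + 1 + ... + 2k.
  toℕ-σ+τ : ∀ i → toℕ (σ ⟨$⟩ʳ i) + toℕ (τ ⟨$⟩ʳ i) ≡ toℕ i + k
  toℕ-σ+τ i = trans (toℕ-cells (Inverse.from alternating i))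
    (cong (λ j → toℕ j + k) (Inverse.strictlyInverseˡ alternating i))

-- Assignment of blocks to slots.

Slot : Set
Slot = Fin 2 ⊎ (Fin 3 × Fin 3)

-- inj₁ e is the edge e of P₃, and inj₂ (p , v) joins vertex p of P₃ to vertex v of O₃.
-- As a 3 × 3 array the blocks of the joining edges have all column sums equal to
-- 18; the row of vertex 0 together with edge 0, and the row of vertex 2 together
-- with edge 1, both have sum 18 as well.
block : Slot ↔ Fin 11
block = mk↔ₛ′ to from (from-yes (all? λ r → to (from r) ≟F r)) from∘to
  where
  to : Slot → Fin 11
  to (inj₁ 0F)        = # 0
  to (inj₁ 1F)        = # 1
  to (inj₂ (0F , 0F)) = # 9
  to (inj₂ (0F , 1F)) = # 2
  to (inj₂ (0F , 2F)) = # 7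
  to (inj₂ (1F , 0F)) = # 5
  to (inj₂ (1F , 1F)) = # 6
  to (inj₂ (1F , 2F)) = # 8
  to (inj₂ (2F , 0F)) = # 4
  to (inj₂ (2F , 1F)) = # 10
  to (inj₂ (2F , 2F)) = # 3
  from : Fin 11 → Slot
  from 0F = inj₁ 0F
  from 1F = inj₁ 1F
  from 2F = inj₂ (0F , 1F)
  from 3F = inj₂ (2F , 2F)
  from 4F = inj₂ (2F , 0F)
  from 5F = inj₂ (1F , 0F)
  from 6F = inj₂ (1F , 1F)
  from 7F = inj₂ (0F , 2F)
  from 8F = inj₂ (1F , 2F)
  from 9F = inj₂ (0F , 0F)
  from (fsuc 9F) = inj₂ (2F , 1F)
  from∘to : ∀ s → from (to s) ≡ s
  from∘to (inj₁ 0F)        = refl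
  from∘to (inj₁ 1F)        = refl
  from∘to (inj₂ (0F , 0F)) = refl
  from∘to (inj₂ (0F , 1F)) = refl
  from∘to (inj₂ (0F , 2F)) = refl
  from∘to (inj₂ (1F , 0F)) = refl
  from∘to (inj₂ (1F , 1F)) = refl
  from∘to (inj₂ (1F , 2F)) = refl
  from∘to (inj₂ (2F , 0F)) = refl
  from∘to (inj₂ (2F , 1F)) = refl
  from∘to (inj₂ (2F , 2F)) = refl

-- The labeling and its vertex colors.

module Construction (k : ℕ) where

  open Halving k using (σ; τ; toℕ-σ+τ)

  N : ℕ
  N = 2 * k + 1

  Γ : Graph
  Γ = (N copiesOf P₃) ∨ O₃

  -- Each end vertex sees two identities and two reversals. In each column the rows of vertices 0
  -- and 2 hold one identity and one reversal.
  order : Slot → Permutation′ N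
  order (inj₁ 0F)        = idₚ
  order (inj₁ 1F)        = reverse
  order (inj₂ (0F , 0F)) = reverse
  order (inj₂ (0F , 1F)) = idₚ
  order (inj₂ (0F , 2F)) = reverse
  order (inj₂ (1F , 0F)) = reverse
  order (inj₂ (1F , 1F)) = σ
  order (inj₂ (1F , 2F)) = τ
  order (inj₂ (2F , 0F)) = idₚ
  order (inj₂ (2F , 1F)) = reverse
  order (inj₂ (2F , 2F)) = idₚ

  slot : E Γ → Slot
  slot (inj₁ (_ , e))              = inj₁ e
  slot (inj₂ (inj₂ ((_ , p) , v))) = inj₂ (p , v)

  copy : E Γ → Fin N
  copy (inj₁ (i , _))              = i
  copy (inj₂ (inj₂ ((i , _) , _))) = i

  slotting : E Γ ↔ (Slot × Fin N)
  slotting = mk↔ₛ′ (λ e → slot e , order (slot e) ⟨$⟩ʳ copy e) from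
    (λ { (inj₁ e , j)       → cong (inj₁ e ,_) (inverseʳ (order (inj₁ e)))
       ; (inj₂ (p , v) , j) → cong (inj₂ (p , v) ,_) (inverseʳ (order (inj₂ (p , v)))) })
    (λ { (inj₁ (i , e))              → cong (λ i → inj₁ (i , e)) (inverseˡ (order (inj₁ e)))
       ; (inj₂ (inj₂ ((i , p) , v))) →
           cong (λ i → inj₂ (inj₂ ((i , p) , v))) (inverseˡ (order (inj₂ (p , v)))) })
    where
    from : Slot × Fin N → E Γ
    from (inj₁ e       , j) = inj₁ (order (inj₁ e) ⟨$⟩ˡ j , e)
    from (inj₂ (p , v) , j) = inj₂ (inj₂ ((order (inj₂ (p , v)) ⟨$⟩ˡ j , p) , v))

  f : Labeling Γ
  f = ↔⇒⤖ (cast-id (size N) ↔-∘ (↔-sym *↔× ↔-∘ ((block ×-↔ ↔-id _) ↔-∘ slotting)))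
    where
    -- The right side is the edge count of `Γ` as it unfolds: two edges per path, none in `O₃`, nine
    -- joining edges per path.
    size : ∀ n → 11 * n ≡ n * 2 + (0 + n * 3 * 3)
    size = solve-∀

  slotLabel : Slot → Fin N → ℕ
  slotLabel s i = suc (N * toℕ (Inverse.to block s) + toℕ (order s ⟨$⟩ʳ i))

  label-f : ∀ e → label Γ f e ≡ slotLabel (slot e) (copy e)
  label-f e = cong suc (trans (toℕ-cast _ _) (toℕ-combine (Inverse.to block (slot e)) _))

  color-path : ∀ i p → (Γ ⁺) f (inj₁ (i , p)) ≡
    incidentSum P₃ (λ e → slotLabel (inj₁ e) i) p
    + sum (map (λ v → slotLabel (inj₂ (p , v)) i) (vertices O₃))
  color-path i p = trans (incidentSum-∨ˡ (N copiesOf P₃) O₃ (label Γ f) (i , p)) (cong₂ _+_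
    (trans (incidentSum-copies N P₃ (label Γ f ∘ inj₁) i p)
      (cong sum (map-cong (λ e → label-f (inj₁ (i , e))) (incidentEdges P₃ p))))
    (cong sum (map-cong (λ v → label-f (inj₂ (inj₂ ((i , p) , v)))) (vertices O₃))))

  color-apex : ∀ v → (Γ ⁺) f (inj₂ v) ≡
    sum (map (λ i → sum (map (λ p → slotLabel (inj₂ (p , v)) i) (vertices P₃))) (allFin N))
  color-apex v = begin
    (Γ ⁺) f (inj₂ v)
      -- The summand coming from `O₃` reduces to 0.
      ≡⟨ incidentSum-∨ʳ (N copiesOf P₃) O₃ (label Γ f) v ⟩
    sum (map (λ u → label Γ f (inj₂ (inj₂ (u , v)))) (vertices (N copiesOf P₃)))
      ≡⟨ cong sum (map-cong (λ u → label-f (inj₂ (inj₂ (u , v)))) (vertices (N copiesOf P₃))) ⟩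
    sum (map (λ (i , p) → slotLabel (inj₂ (p , v)) i) (vertices (N copiesOf P₃)))
      ≡⟨ cong (sum ∘ map _) (vertices-copies N P₃) ⟩
    sum (map (λ (i , p) → slotLabel (inj₂ (p , v)) i) (cartesianProduct (allFin N) (vertices P₃)))
      ≡⟨ sum-cartesianProduct (λ (i , p) → slotLabel (inj₂ (p , v)) i) (allFin N) (vertices P₃) ⟩
    sum (map (λ i → sum (map (λ p → slotLabel (inj₂ (p , v)) i) (vertices P₃))) (allFin N)) ∎
    where open ≡-Reasoning

  -- An end vertex has four labels with block sum 18 and two identity-reversal pairs: 4 + 18N + 2(N
  -- - 1). A middle vertex has five with block sum 20, two such pairs and the shift: 5 + 20N + 2(N -
  -- 1) + k. Each path gives an apex three labels with block sum 18, one pair and a permutation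
  -- value: 3 + 18N + (N - 1) + π(i).
  endColor midColor apexColor : ℕ
  endColor  = 2 + 20 * N
  midColor  = 3 + 22 * N + k
  apexColor = N * (2 + 19 * N) + sum (tabulate {n = N} toℕ)

  colorOf : V Γ → ℕ
  colorOf (inj₁ (_ , 0F)) = endColor
  colorOf (inj₁ (_ , 1F)) = midColor
  colorOf (inj₁ (_ , 2F)) = endColor
  colorOf (inj₂ _)        = apexColor

  end-sum : (i : Fin N) → 2 + 18 * N + 2 * suc (toℕ i + toℕ (opposite i)) ≡ endColor
  end-sum i = trans (cong (λ n → 2 + 18 * N + 2 * n) (toℕ-opposite i)) (collect N)
    where
    collect : ∀ n → 2 + 18 * n + 2 * n ≡ 2 + 20 * n
    collect = solve-∀

  color-f : ∀ u → (Γ ⁺) f u ≡ colorOf u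
  color-f (inj₁ (i , 0F)) = trans (color-path i 0F)
    (trans (arith N (toℕ i) (toℕ (opposite i))) (end-sum i))
    where
    arith : ∀ n x y →
      (suc (n * 0 + x) + 0)
        + (suc (n * 9 + y) + (suc (n * 2 + x) + (suc (n * 7 + y) + 0)))
      ≡ 2 + 18 * n + 2 * suc (x + y)
    arith = solve-∀
  color-f (inj₁ (i , 1F)) = begin
    (Γ ⁺) f (inj₁ (i , 1F))
      ≡⟨ color-path i 1F ⟩
    _ ≡⟨ arith N (toℕ i) (toℕ (opposite i)) (toℕ (σ ⟨$⟩ʳ i)) (toℕ (τ ⟨$⟩ʳ i)) ⟩
    5 + 20 * N + (toℕ i + 2 * toℕ (opposite i)) + (toℕ (σ ⟨$⟩ʳ i) + toℕ (τ ⟨$⟩ʳ i))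
      -- The sum of σ and τ supplies the second i, so that both reversals are paired.
      ≡⟨ cong (5 + 20 * N + (toℕ i + 2 * toℕ (opposite i)) +_) (toℕ-σ+τ i) ⟩
    5 + 20 * N + (toℕ i + 2 * toℕ (opposite i)) + (toℕ i + k)
      ≡⟨ regroup N (toℕ i) (toℕ (opposite i)) k ⟩
    3 + 20 * N + 2 * suc (toℕ i + toℕ (opposite i)) + k
      ≡⟨ cong (λ n → 3 + 20 * N + 2 * n + k) (toℕ-opposite i) ⟩
    3 + 20 * N + 2 * N + k
      ≡⟨ collect N k ⟩
    midColor ∎
    where
    open ≡-Reasoning
    arith : ∀ n x y s t →
      (suc (n * 0 + x) + (suc (n * 1 + y) + 0))
        + (suc (n * 5 + y) + (suc (n * 6 + s) + (suc (n * 8 + t) + 0)))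
      ≡ 5 + 20 * n + (x + 2 * y) + (s + t)
    arith = solve-∀
    regroup : ∀ n x y k → 5 + 20 * n + (x + 2 * y) + (x + k) ≡ 3 + 20 * n + 2 * suc (x + y) + k
    regroup = solve-∀
    collect : ∀ n k → 3 + 20 * n + 2 * n + k ≡ 3 + 22 * n + k
    collect = solve-∀
  color-f (inj₁ (i , 2F)) = trans (color-path i 2F)
    (trans (arith N (toℕ i) (toℕ (opposite i))) (end-sum i))
    where
    arith : ∀ n x y →
      (suc (n * 1 + y) + 0)
        + (suc (n * 4 + x) + (suc (n * 10 + y) + (suc (n * 3 + x) + 0)))
      ≡ 2 + 18 * n + 2 * suc (x + y)
    arith = solve-∀
  color-f (inj₂ v) = trans (color-apex v) (trans
    (cong sum (map-cong (column v) (allFin N)))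
    (sum-allFin-permute (2 + 19 * N) (order (inj₂ (1F , v)))))
    where
    arith₁ : ∀ n x y z →
      suc (n * 9 + y) + (suc (n * 5 + z) + (suc (n * 4 + x) + 0)) ≡ 2 + 18 * n + suc (x + y) + z
    arith₁ = solve-∀
    arith₂ : ∀ n x y z →
      suc (n * 2 + x) + (suc (n * 6 + z) + (suc (n * 10 + y) + 0)) ≡ 2 + 18 * n + suc (x + y) + z
    arith₂ = solve-∀
    arith₃ : ∀ n x y z →
      suc (n * 7 + y) + (suc (n * 8 + z) + (suc (n * 3 + x) + 0)) ≡ 2 + 18 * n + suc (x + y) + z
    arith₃ = solve-∀
    collect : ∀ n z → 2 + 18 * n + n + z ≡ 2 + 19 * n + z
    collect = solve-∀
    column : ∀ v i → sum (map (λ p → slotLabel (inj₂ (p , v)) i) (vertices P₃)) ≡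
      2 + 19 * N + toℕ (order (inj₂ (1F , v)) ⟨$⟩ʳ i)
    column v i = trans (before v)
      (trans (cong (λ n → 2 + 18 * N + n + z) (toℕ-opposite i)) (collect N z))
      where
      z = toℕ (order (inj₂ (1F , v)) ⟨$⟩ʳ i)
      before : ∀ v → sum (map (λ p → slotLabel (inj₂ (p , v)) i) (vertices P₃)) ≡
        2 + 18 * N + suc (toℕ i + toℕ (opposite i)) + toℕ (order (inj₂ (1F , v)) ⟨$⟩ʳ i)
      before 0F = arith₁ N (toℕ i) (toℕ (opposite i)) _
      before 1F = arith₂ N (toℕ i) (toℕ (opposite i)) _
      before 2F = arith₃ N (toℕ i) (toℕ (opposite i)) _

  -- The lower bound, and separation of the three colors.

  3≤colorNumber : (g : Labeling Γ) → LocalAntimagic Γ g → 3 ≤ colorNumber Γ g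
  3≤colorNumber g g-antimagic = colorNumber-≥ Γ g
    -- A triangle: its three edges make the three colors pairwise distinct.
    {inj₁ (i , 0F) ∷ inj₁ (i , 1F) ∷ inj₂ 0F ∷ []}
    ((g-antimagic (inj₁ (i , 0F)) ∷ g-antimagic (inj₂ (inj₂ ((i , 0F) , 0F))) ∷ [])
      ∷ (g-antimagic (inj₂ (inj₂ ((i , 1F) , 0F))) ∷ []) ∷ [] ∷ [])
    where
    i : Fin N
    -- Any copy would do. As `2 * k + 1` does not reduce to a successor, the last index 2k is
    -- written directly.
    i = 2 * k ↑ʳ 0F

  colorNumber-f≤3 : colorNumber Γ f ≤ 3
  colorNumber-f≤3 = colorNumber-≤ Γ f {endColor ∷ midColor ∷ apexColor ∷ []} λ u →
    subst (_∈ _) (sym (color-f u)) (listed u)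
    where
    listed : ∀ u → colorOf u ∈ endColor ∷ midColor ∷ apexColor ∷ []
    listed (inj₁ (_ , 0F)) = here refl
    listed (inj₁ (_ , 1F)) = there (here refl)
    listed (inj₁ (_ , 2F)) = here refl
    listed (inj₂ _)        = there (there (here refl))

  endColor<midColor : endColor < midColor
  endColor<midColor = subst (endColor <_) (arith N k) (m≤m+n (suc endColor) (2 * N + k))
    where
    arith : ∀ n k → suc (2 + 20 * n) + (2 * n + k) ≡ 3 + 22 * n + k
    arith = solve-∀

  midColor<apexColor : 1 ≤ k → midColor < apexColor
  midColor<apexColor (s≤s {n = j} _) = ≤-trans
    -- With k = j + 1 the polynomial is N(2 + 19N) - (`midColor` + 1). The remaining summand of
    -- `apexColor` only adds to it.
    (subst (midColor <_) (arith j) (m≤m+n (suc midColor) (106 + 187 * j + 76 * (j * j))))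
    (m≤m+n (N * (2 + 19 * N)) _)
    where
    arith : ∀ j →
      suc (3 + 22 * (2 * suc j + 1) + suc j) + (106 + 187 * j + 76 * (j * j))
      ≡ (2 * suc j + 1) * (2 + 19 * (2 * suc j + 1))
    arith = solve-∀

  -- Every edge joins vertices of two different kinds among end, middle and apex, and the colors of
  -- these kinds strictly increase in that order.
  f-localAntimagic : 1 ≤ k → LocalAntimagic Γ f
  f-localAntimagic 1≤k e eq =
    separated e (trans (sym (color-f (proj₁ (ends Γ e)))) (trans eq (color-f (proj₂ (ends Γ e)))))
    where
    end≢mid  = <⇒≢ endColor<midColor
    mid≢apex = <⇒≢ (midColor<apexColor 1≤k)
    end≢apex = <⇒≢ (<-trans endColor<midColor (midColor<apexColor 1≤k))
    separated : ∀ e → colorOf (proj₁ (ends Γ e)) ≢ colorOf (proj₂ (ends Γ e))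
    separated (inj₁ (_ , 0F))              = end≢mid
    separated (inj₁ (_ , 1F))              = end≢mid ∘ sym
    separated (inj₂ (inj₂ ((_ , 0F) , _))) = end≢apex
    separated (inj₂ (inj₂ ((_ , 1F) , _))) = mid≢apex
    separated (inj₂ (inj₂ ((_ , 2F) , _))) = end≢apex

theorem4p1 : ∀ (k : ℕ) → 1 ≤ k → χla≡ (((2 * k + 1) copiesOf P₃) ∨ O₃) 3
theorem4p1 k 1≤k =
  (f , antimagic , ≤-antisym colorNumber-f≤3 (3≤colorNumber f antimagic)) , 3≤colorNumber
  where
  open Construction k
  antimagic = f-localAntimagic 1≤k
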